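{- Let $m\ge 2$. For $n\ge 0$ define $$Q^{(m)}_{n,132}(x_2,\ldots,x_m)=\sum_{\sigma\in\mathcal{S}_n(132)}x_2^{\mathrm{occr}_{12}(\sigma)}x_3^{\mathrm{occr}_{123}(\sigma)}\cdots x_m^{\mathrm{occr}_{12\cdots m}(\sigma)},\qquad Q^{(m)}_{132}(t,x_2,\ldots,x_m)=\sum_{n\ge 0}t^n Q^{(m)}_{n,132}(x_2,\ldots,x_m).$$ Then for every $n\ge 1$, $$Q^{(m)}_{n,132}(x_2,\ldots,x_m)=\sum_{k=1}^{n}x_2^{k-1}\,Q^{(m)}_{k-1,132}(x_2x_3,\,x_3x_4,\ldots,x_{m-1}x_m,\,x_m)\,Q^{(m)}_{n-k,132}(x_2,\ldots,x_m),$$ and $$Q^{(m)}_{132}(t,x_2,\ldots,x_m)=1+t\,Q^{(m)}_{132}(tx_2,\,x_2x_3,\,x_3x_4,\ldots,x_{m-1}x_m,\,x_m)\,Q^{(m)}_{132}(t,x_2,\ldots,x_m).$$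
   Context: $\mathcal{S}_n$ is the set of permutations of $\{1,\ldots,n\}$ in one-line notation ($\mathcal{S}_0$ consists of the empty permutation, so the $n=0$ polynomial is $1$). For a sequence $w$ of distinct integers, $\mathrm{red}(w)$ is the permutation obtained by replacing the $i$-th smallest entry of $w$ by $i$. For $\tau\in\mathcal{S}_j$ and $\sigma=\sigma_1\cdots\sigma_n\in\mathcal{S}_n$, $\mathrm{occr}_\tau(\sigma)$ is the number of index sets $1\le i_1<\cdots<i_j\le n$ with $\mathrm{red}(\sigma_{i_1}\cdots\sigma_{i_j})=\tau$. $\mathcal{S}_n(132)$ is the set of $\sigma\in\mathcal{S}_n$ with $\mathrm{occr}_{132}(\sigma)=0$. In the argument list $(x_2x_3,x_3x_4,\ldots,x_{m-1}x_m,x_m)$ the variable $x_i$ is replaced by $x_ix_{i+1}$ for $2\le i\le m-1$ and $x_m$ is left unchanged (for $m=2$ the list is just $(x_2)$). -}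

module Defs where

open import Data.Fin.Base using (Fin; toℕ)
open import Data.Integer.Base as ℤ using (ℤ; 0ℤ; 1ℤ)
open import Data.List.Base
  using (List; []; _∷_; [_]; _++_; map; foldr; filter; length; applyUpTo; upTo; cartesianProductWith)
import Data.List.Properties as List
import Data.List.Relation.Unary.Unique.DecPropositional as Unique
open import Data.Nat.Base as ℕ using (ℕ; zero; suc; _∸_)
import Data.Nat.Properties as ℕ
open import Data.Product.Base using (_×_; _,_; proj₁; proj₂)
open import Data.Vec.Base as Vec using (Vec; []; _∷_)
import Data.Vec.Properties as Vec
open import Relation.Binary.PropositionalEquality using (_≡_)

Word : Set
Word = List ℕ

wordsOver : List ℕ → ℕ → List Word
wordsOver as zero    = [ [] ]
wordsOver as (suc l) = cartesianProductWith _∷_ as (wordsOver as l)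

oneTo : ℕ → List ℕ
oneTo n = applyUpTo suc n

-- A word of length n over {1,…,n} is a permutation iff its letters are distinct.
𝒮 : ℕ → List Word
𝒮 n = filter (Unique.unique? ℕ._≟_) (wordsOver (oneTo n) n)

-- In a word with distinct letters, a is the i-th smallest letter
-- exactly when i letters are ≤ a.
red : Word → Word
red w = map (λ a → length (filter (ℕ._≤? a) w)) w

-- One entry for each index set i₁ < ⋯ < i_j of positions.
subwords : ℕ → Word → List Word
subwords zero    _       = [ [] ]
subwords (suc j) []      = []
subwords (suc j) (a ∷ w) = map (a ∷_) (subwords j w) ++ subwords (suc j) w

occr : Word → Word → ℕ
occr τ σ = length (filter (λ w → List.≡-dec ℕ._≟_ (red w) τ) (subwords (length τ) σ))

𝒮132 : ℕ → List Word
𝒮132 n = filter (λ σ → occr (1 ∷ 3 ∷ 2 ∷ []) σ ℕ.≟ 0) (𝒮 n)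

-- Polynomials over ℤ in v variables, as finite formal sums of terms
-- (coefficient, exponent vector).  Exponent vectors may repeat, so equality
-- of polynomials is _≈_, equality of all coefficients.

Poly : ℕ → Set
Poly v = List (ℤ × Vec ℕ v)

private variable
  v w : ℕ

coeff : Poly v → Vec ℕ v → ℤ
coeff p e =
  foldr ℤ._+_ 0ℤ (map proj₁ (filter (λ t → Vec.≡-dec ℕ._≟_ (proj₂ t) e) p))

infix 4 _≈_
_≈_ : Poly v → Poly v → Set
p ≈ q = ∀ e → coeff p e ≡ coeff q e

monomial : Vec ℕ v → Poly v
monomial e = [ (1ℤ , e) ]

const : ℤ → Poly v
const {v} c = [ (c , Vec.replicate v 0) ]

0ₚ 1ₚ : Poly v
0ₚ = []
1ₚ = const 1ℤ

var : Fin v → Poly v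
var {v} i = monomial (Vec.replicate v 0 Vec.[ i ]≔ 1)

vars : ∀ v → Vec (Poly v) v
vars v = Vec.tabulate var

infixl 6 _+ₚ_
infixl 7 _*ₚ_
infixr 8 _^ₚ_

_+ₚ_ _*ₚ_ : Poly v → Poly v → Poly v
_+ₚ_ = _++_
_*ₚ_ = cartesianProductWith λ (c , e) (d , f) → c ℤ.* d , Vec.zipWith ℕ._+_ e f

_^ₚ_ : Poly v → ℕ → Poly v
p ^ₚ zero  = 1ₚ
p ^ₚ suc n = p *ₚ p ^ₚ n

∑ : List ℕ → (ℕ → Poly v) → Poly v
∑ is f = foldr _+ₚ_ 0ₚ (map f is)

-- p ⟨ y₁ ∷ ⋯ ∷ y_v ∷ [] ⟩ is p(y₁,…,y_v).
infixl 9 _⟨_⟩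
_⟨_⟩ : Poly v → Vec (Poly w) v → Poly w
p ⟨ ys ⟩ = foldr _+ₚ_ 0ₚ
  (map (λ (c , e) → const c *ₚ Vec.foldr′ _*ₚ_ 1ₚ (Vec.zipWith _^ₚ_ ys e)) p)

-- Formal power series in t with polynomial coefficients: F n is [tⁿ] F.

Series : ℕ → Set
Series v = ℕ → Poly v

infix 4 _≈ₛ_
_≈ₛ_ : Series v → Series v → Set
F ≈ₛ G = ∀ n → F n ≈ G n

constₛ : Poly v → Series v
constₛ p zero    = p
constₛ p (suc _) = 0ₚ

1ₛ : Series v
1ₛ = constₛ 1ₚ

t : Series v
t 1 = 1ₚ
t _ = 0ₚ

infixl 6 _+ₛ_
infixl 7 _*ₛ_
infixr 8 _^ₛ_

_+ₛ_ _*ₛ_ : Series v → Series v → Series v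
(F +ₛ G) n = F n +ₚ G n
(F *ₛ G) n = ∑ (upTo (suc n)) λ i → F i *ₚ G (n ∸ i)

_^ₛ_ : Series v → ℕ → Series v
F ^ₛ zero  = 1ₛ
F ^ₛ suc n = F *ₛ F ^ₛ n

-- F ⟦ U , ys ⟧ is F(U, y₁,…,y_v) = Σ_{n≥0} Uⁿ F_n(y₁,…,y_v), meaningful when U
-- has zero constant term: then Uⁿ contributes nothing to [t^N] for n > N, so
-- the sum may be cut off at n = N.
infixl 9 _⟦_,_⟧
_⟦_,_⟧ : Series v → Series w → Vec (Poly w) v → Series w
(F ⟦ U , ys ⟧) N = ∑ (upTo (suc N)) λ n → (U ^ₛ n *ₛ constₛ (F n ⟨ ys ⟩)) N

-- The m ∸ 1 variables are x₂,…,x_m: index i stands for x_{i+2}, whose exponent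
-- is the number of occurrences of 12⋯(i+2).
weight : ∀ m → Word → Vec ℕ (m ∸ 1)
weight m σ = Vec.tabulate λ i → occr (oneTo (2 ℕ.+ toℕ i)) σ

Q : ∀ m → ℕ → Poly (m ∸ 1)
Q m n = foldr _+ₚ_ 0ₚ (map (λ σ → monomial (weight m σ)) (𝒮132 n))

Qₜ : ∀ m → Series (m ∸ 1)
Qₜ m = Q m

-- (y₁, …, y_v) ↦ (y₁y₂, y₂y₃, …, y_{v-1}y_v, y_v)
mergeNext : ∀ {n} → Vec (Poly v) n → Vec (Poly v) n
mergeNext []           = []
mergeNext (y ∷ [])     = y ∷ []
mergeNext (y ∷ z ∷ ys) = y *ₚ z ∷ mergeNext (z ∷ ys)

{-# OPTIONS --safe #-}
module Submission where

-- Let n be the maximum of a 132-avoiding σ = α n β.  Every letter of α exceeds every letter of β,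
-- so α is a shifted 132-avoider, β is a 132-avoider, and each pair of avoiders of total length
-- n − 1 arises exactly once.  An increasing subword of σ lies in α, or lies in β, or is an
-- increasing subword of α followed by n, whence
--   occr_{1⋯j+1}(σ) = occr_{1⋯j+1}(α) + occr_{1⋯j}(α) + occr_{1⋯j+1}(β);
-- the middle term is what the substitution x_i ↦ x_i x_{i+1} and the factor x₂^{k−1} record.
-- All the polynomials involved are lists of terms with coefficient 1, and the two sides of the
-- recurrence are permutations of each other.  The coefficients of the series on the right-hand side
-- are equal, as lists, to the right-hand sides of the recurrence.

open import Defs
open import Data.Bool.Base using (true; false)
open import Data.Fin.Base using (Fin; zero; suc; toℕ)
open import Data.Integer.Base using (ℤ; 1ℤ)
import Data.Integer.Properties as ℤ
open import Data.List.Base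
  using (List; []; _∷_; _++_; map; foldr; filter; length; applyUpTo; upTo; concat; cartesianProduct)
import Data.List.Properties as List
open import Data.List.Membership.DecPropositional using (_∈?_)
open import Data.List.Membership.Propositional using (_∈_; _∉_)
import Data.List.Membership.Propositional.Properties as ∈
open import Data.List.Membership.Propositional.Properties.WithK using (unique∧set⇒bag)
open import Data.List.Relation.Binary.BagAndSetEquality using (∼bag⇒↭)
open import Data.List.Relation.Binary.Permutation.Propositional using (_↭_; ↭⇒↭ₛ)
import Data.List.Relation.Binary.Permutation.Propositional.Properties as ↭
import Data.List.Relation.Binary.Permutation.Setoid.Properties as ↭ₛ
open import Data.List.Relation.Binary.Sublist.Propositional
  using (_⊆_; []; _∷_; _∷ʳ_; ⊆-refl; minimum; from∈)
import Data.List.Relation.Binary.Sublist.Propositional.Properties as ⊆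
open import Data.List.Relation.Unary.All as All using (All; []; _∷_)
import Data.List.Relation.Unary.All.Properties as All
open import Data.List.Relation.Unary.AllPairs using (AllPairs; []; _∷_)
import Data.List.Relation.Unary.AllPairs.Properties as AllPairs
open import Data.List.Relation.Unary.Any using (here; there)
open import Data.List.Relation.Unary.Linked as Linked using (Linked; [-]; _∷_; linked?)
import Data.List.Relation.Unary.Linked.Properties as Linked
import Data.List.Relation.Unary.Unique.DecPropositional as Unique
open import Data.List.Relation.Unary.Unique.Propositional using (Unique)
import Data.List.Relation.Unary.Unique.Propositional.Properties as Unique
open import Data.Nat.Base
  using (ℕ; zero; suc; _+_; _*_; _∸_; _≤_; _<_; z≤n; s≤s; z<s; s≤s⁻¹)
import Data.Nat.Properties as ℕ
open import Data.Nat.Solver using (module +-*-Solver)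
open import Data.Product.Base using (∃; ∃₂; _×_; _,_; proj₁; proj₂; uncurry)
open import Data.Sum.Base using (inj₁; inj₂)
open import Data.Vec.Base as Vec using (Vec; []; _∷_; zipWith; replicate; tabulate)
import Data.Vec.Properties as Vec
open import Function.Base using (_∘_; id)
open import Function.Bundles using (mk⇔)
open import Level using (Level)
open import Relation.Binary.PropositionalEquality
  using (_≡_; _≢_; refl; sym; trans; cong; cong₂; subst; setoid; module ≡-Reasoning)
open import Relation.Nullary using (¬_; yes; no; contradiction; does)
open import Relation.Nullary.Decidable using (decidable-stable)
open import Relation.Unary using (Pred; Decidable)

private variable
  ℓ ℓ′ : Level
  X Y : Set ℓ
  v w d : ℕ

-- Occurrences of increasing patterns

filter-map : {P : Pred Y ℓ′} (P? : Decidable P) (f : X → Y) (xs : List X) →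
  filter P? (map f xs) ≡ map f (filter (P? ∘ f) xs)
filter-map P? f []       = refl
filter-map P? f (x ∷ xs) with does (P? (f x))
... | false = filter-map P? f xs
... | true  = cong (f x ∷_) (filter-map P? f xs)

length-filter-map : {P : Pred Y ℓ′} (P? : Decidable P) (f : X → Y) (xs : List X) →
  length (filter P? (map f xs)) ≡ length (filter (P? ∘ f) xs)
length-filter-map P? f xs =
  trans (cong length (filter-map P? f xs)) (List.length-map f (filter (P? ∘ f) xs))

∈-subwords⁻ : ∀ j σ {w} → w ∈ subwords j σ → w ⊆ σ × length w ≡ j
∈-subwords⁻ zero    σ       (here refl) = minimum σ , refl
∈-subwords⁻ (suc j) (a ∷ σ) w∈ with ∈.∈-++⁻ (map (a ∷_) (subwords j σ)) w∈
... | inj₁ w∈ˡ with _ , u∈ , refl ← ∈.∈-map⁻ (a ∷_) w∈ˡ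
               with u⊆σ , |u| ← ∈-subwords⁻ j σ u∈ = refl ∷ u⊆σ , cong suc |u|
... | inj₂ w∈ʳ with w⊆σ , |w| ← ∈-subwords⁻ (suc j) σ w∈ʳ = a ∷ʳ w⊆σ , |w|

∈-subwords⁺ : ∀ {w σ} → w ⊆ σ → w ∈ subwords (length w) σ
∈-subwords⁺ {[]} _ = here refl
∈-subwords⁺ {b ∷ w} {a ∷ σ} (.a ∷ʳ τ) =
  ∈.∈-++⁺ʳ (map (a ∷_) (subwords (length w) σ)) (∈-subwords⁺ τ)
∈-subwords⁺ {b ∷ w} {a ∷ σ} (refl ∷ τ) =
  ∈.∈-++⁺ˡ (∈.∈-map⁺ (a ∷_) (∈-subwords⁺ τ))

subwords-map : ∀ (f : ℕ → ℕ) j σ → subwords j (map f σ) ≡ map (map f) (subwords j σ)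
subwords-map f zero    σ       = refl
subwords-map f (suc j) []      = refl
subwords-map f (suc j) (a ∷ σ) = begin
  map (f a ∷_) (subwords j (map f σ)) ++ subwords (suc j) (map f σ)
    ≡⟨ cong₂ (λ u v → map (f a ∷_) u ++ v) (subwords-map f j σ) (subwords-map f (suc j) σ) ⟩
  map (f a ∷_) (map (map f) (subwords j σ)) ++ map (map f) (subwords (suc j) σ)
    ≡⟨ cong (_++ _) (trans (sym (List.map-∘ (subwords j σ))) (List.map-∘ (subwords j σ))) ⟩
  map (map f) (map (a ∷_) (subwords j σ)) ++ map (map f) (subwords (suc j) σ)
    ≡⟨ List.map-++ (map f) (map (a ∷_) (subwords j σ)) _ ⟨
  map (map f) (subwords (suc j) (a ∷ σ)) ∎
  where open ≡-Reasoning

rank : Word → ℕ → ℕ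
rank w a = length (filter (ℕ._≤? a) w)

rank-mono : ∀ w {a b} → a ≤ b → rank w a ≤ rank w b
rank-mono w {a} {b} a≤b = ⊆.length-mono-≤
  (⊆.filter⁺ (ℕ._≤? a) (ℕ._≤? b) (λ { refl x≤a → ℕ.≤-trans x≤a a≤b }) (⊆-refl {x = w}))

rank-accept : ∀ w {x a} → x ≤ a → rank (x ∷ w) a ≡ suc (rank w a)
rank-accept w {a = a} x≤a = cong length (List.filter-accept (ℕ._≤? a) x≤a)

rank-reject : ∀ w {x a} → a < x → rank (x ∷ w) a ≡ rank w a
rank-reject w {a = a} a<x = cong length (List.filter-reject (ℕ._≤? a) (ℕ.<⇒≱ a<x))

red-shift : ∀ l w → red (map (l +_) w) ≡ red w
red-shift l w = trans (sym (List.map-∘ w)) (List.map-cong rank-shift w)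
  where
  rank-shift : ∀ a → rank (map (l +_) w) (l + a) ≡ rank w a
  rank-shift a = trans (length-filter-map (ℕ._≤? (l + a)) (l +_) w)
    (cong length (List.filter-≐ (λ b → l + b ℕ.≤? l + a) (ℕ._≤? a)
      (ℕ.+-cancelˡ-≤ l _ _ , ℕ.+-monoʳ-≤ l) w))

occr-shift : ∀ τ l σ → occr τ (map (l +_) σ) ≡ occr τ σ
occr-shift τ l σ = begin
  length (filter P? (subwords (length τ) (map (l +_) σ)))
    ≡⟨ cong (length ∘ filter P?) (subwords-map (l +_) (length τ) σ) ⟩
  length (filter P? (map (map (l +_)) S))
    ≡⟨ length-filter-map P? (map (l +_)) S ⟩
  length (filter (P? ∘ map (l +_)) S)
    ≡⟨ cong length (List.filter-≐ (P? ∘ map (l +_)) P?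
         ((λ {w} → trans (sym (red-shift l w))) , λ {w} → trans (red-shift l w)) S) ⟩
  length (filter P? S) ∎
  where
  open ≡-Reasoning
  S  = subwords (length τ) σ
  P? = λ w → List.≡-dec ℕ._≟_ (red w) τ

-- `rank w` is weakly monotone, so a strict inequality between neighbouring ranks reflects to the
-- letters themselves.
red≡oneTo⇒increasing : ∀ j w → red w ≡ oneTo j → Linked _<_ w
red≡oneTo⇒increasing j w eq =
  Linked.map (λ r< → ℕ.≰⇒> (ℕ.<⇒≱ r< ∘ rank-mono w))
    (Linked.map⁻ (subst (Linked _<_) (sym eq) (Linked.applyUpTo⁺₂ suc j (λ _ → ℕ.≤-refl))))

-- The head lies below every later letter: its own rank is 1, and it adds 1 to each rank in the
-- tail.
increasing⇒red≡oneTo : ∀ {w} → Linked _<_ w → red w ≡ oneTo (length w)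
increasing⇒red≡oneTo = go ∘ Linked.Linked⇒AllPairs ℕ.<-trans
  where
  go : ∀ {w} → AllPairs _<_ w → red w ≡ oneTo (length w)
  go []                 = refl
  go {a ∷ w} (a<w ∷ w↗) = cong₂ _∷_
    (trans (rank-accept w ℕ.≤-refl)
           (cong (suc ∘ length) (List.filter-none (ℕ._≤? a) (All.map ℕ.<⇒≱ a<w))))
    (begin
      map (rank (a ∷ w)) w       ≡⟨ List.map-cong-local (All.map (rank-accept w ∘ ℕ.<⇒≤) a<w) ⟩
      map (suc ∘ rank w) w       ≡⟨ List.map-∘ w ⟩
      map suc (red w)            ≡⟨ cong (map suc) (go w↗) ⟩
      map suc (oneTo (length w)) ≡⟨ List.map-applyUpTo suc suc (length w) ⟩
      applyUpTo (2 +_) (length w) ∎)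
    where open ≡-Reasoning

Ascending : ℕ → Word → Set
Ascending b w = Linked _<_ (b ∷ w)

ascending? : ∀ b → Decidable (Ascending b)
ascending? b w = linked? ℕ._<?_ (b ∷ w)

-- b bounds the letters from below, so that the count obeys a recursion on σ.
#asc : ℕ → ℕ → Word → ℕ
#asc j b σ = length (filter (ascending? b) (subwords j σ))

All-subwords : ∀ {P : Pred ℕ ℓ} j σ → All P σ → All (All P) (subwords j σ)
All-subwords j σ Pσ = All.tabulate λ w∈ → ⊆.All-resp-⊆ (proj₁ (∈-subwords⁻ j σ w∈)) Pσ

filter-cong-local : {P Q : Pred X ℓ′} (P? : Decidable P) (Q? : Decidable Q) {xs : List X} →
  All (λ x → (P x → Q x) × (Q x → P x)) xs → filter P? xs ≡ filter Q? xs
filter-cong-local P? Q? [] = refl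
filter-cong-local P? Q? {x ∷ xs} ((P⇒Q , Q⇒P) ∷ rest) with P? x | Q? x
... | yes _  | yes _  = cong (x ∷_) (filter-cong-local P? Q? rest)
... | no  _  | no  _  = filter-cong-local P? Q? rest
... | yes Px | no ¬Qx = contradiction (P⇒Q Px) ¬Qx
... | no ¬Px | yes Qx = contradiction (Q⇒P Qx) ¬Px

-- Positive letters make the bound 0 vacuous, so `Ascending 0 w` says only that `w` increases.
occr-oneTo : ∀ j {σ} → All (0 <_) σ → occr (oneTo j) σ ≡ #asc j 0 σ
occr-oneTo j {σ} 0<σ = trans
  (cong (λ i → length (filter P? (subwords i σ))) (List.length-applyUpTo suc j))
  (cong length (filter-cong-local P? (ascending? 0) (All.tabulate equiv)))
  where
  P? = λ w → List.≡-dec ℕ._≟_ (red w) (oneTo j)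

  equiv : ∀ {w} → w ∈ subwords j σ →
    (red w ≡ oneTo j → Ascending 0 w) × (Ascending 0 w → red w ≡ oneTo j)
  equiv {w} w∈ with refl ← proj₂ (∈-subwords⁻ j σ w∈) =
    (λ eq → prepend (All.lookup (All-subwords j σ 0<σ) w∈) (red≡oneTo⇒increasing j w eq)) ,
    (increasing⇒red≡oneTo ∘ Linked.tail)
    where
    prepend : ∀ {w} → All (0 <_) w → Linked _<_ w → Ascending 0 w
    prepend []        _  = [-]
    prepend (0<a ∷ _) w↗ = 0<a ∷ w↗

#asc-∷ : ∀ j b a σ → #asc (suc j) b (a ∷ σ) ≡
  length (filter (ascending? b ∘ (a ∷_)) (subwords j σ)) + #asc (suc j) b σ
#asc-∷ j b a σ = begin
  length (filter (ascending? b) (map (a ∷_) S ++ T))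
    ≡⟨ cong length (List.filter-++ (ascending? b) (map (a ∷_) S) T) ⟩
  length (filter (ascending? b) (map (a ∷_) S) ++ filter (ascending? b) T)
    ≡⟨ List.length-++ (filter (ascending? b) (map (a ∷_) S)) ⟩
  length (filter (ascending? b) (map (a ∷_) S)) + #asc (suc j) b σ
    ≡⟨ cong (_+ _) (length-filter-map (ascending? b) (a ∷_) S) ⟩
  length (filter (ascending? b ∘ (a ∷_)) S) + #asc (suc j) b σ ∎
  where
  open ≡-Reasoning
  S = subwords j σ
  T = subwords (suc j) σ

-- Once `a` is chosen, it becomes the lower bound for the rest of the subword.
#asc-∷-< : ∀ j {b a} σ → b < a → #asc (suc j) b (a ∷ σ) ≡ #asc j a σ + #asc (suc j) b σ
#asc-∷-< j {b} {a} σ b<a = trans (#asc-∷ j b a σ) (cong (λ xs → length xs + _)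
  (List.filter-≐ (ascending? b ∘ (a ∷_)) (ascending? a) (Linked.tail , (b<a ∷_)) (subwords j σ)))

#asc-∷-≥ : ∀ j {b a} σ → a ≤ b → #asc (suc j) b (a ∷ σ) ≡ #asc (suc j) b σ
#asc-∷-≥ j {b} {a} σ a≤b = trans (#asc-∷ j b a σ) (cong (λ xs → length xs + _)
  (List.filter-none (ascending? b ∘ (a ∷_))
    (All.universal (λ _ → ℕ.≤⇒≯ a≤b ∘ Linked.head) (subwords j σ))))

#asc-none : ∀ j {b σ} → All (_≤ b) σ → #asc (suc j) b σ ≡ 0
#asc-none j []                      = refl
#asc-none j {σ = a ∷ σ} (a≤b ∷ σ≤b) = trans (#asc-∷-≥ j σ a≤b) (#asc-none j σ≤b)

#asc-1 : ∀ {σ} → All (0 <_) σ → #asc 1 0 σ ≡ length σ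
#asc-1 []                  = refl
#asc-1 {a ∷ σ} (0<a ∷ 0<σ) = trans (#asc-∷-< 0 σ 0<a) (cong suc (#asc-1 0<σ))

-- No ascending subword passes from `xs` or `n` into `ys`, where all letters are smaller: it lies in
-- `xs`, lies in `ys`, or ends at `n`. The bound `b` is general because choosing a letter `x` of
-- `xs` replaces it by `x`. The case `j = zero` is separate, as `#asc 0` is always 1.
#asc-split : ∀ j {b n} xs {ys} → b < n → All (_< n) xs → All (_< n) ys →
  All (λ x → All (_< x) ys) xs →
  #asc (suc j) b (xs ++ n ∷ ys) ≡ #asc (suc j) b xs + #asc j b xs + #asc (suc j) b ys
#asc-split zero    [] {ys}  b<n _ ys<n _ = #asc-∷-< 0 ys b<n
#asc-split (suc j) [] {ys}  b<n _ ys<n _ =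
  trans (#asc-∷-< (suc j) ys b<n) (cong (_+ _) (#asc-none j (All.map ℕ.<⇒≤ ys<n)))
#asc-split j {b} {n} (x ∷ xs) {ys} b<n (x<n ∷ xs<n) ys<n (ys<x ∷ ys<xs) with b ℕ.<? x
#asc-split zero {b} {n} (x ∷ xs) {ys} b<n (x<n ∷ xs<n) ys<n (ys<x ∷ ys<xs) | yes b<x = begin
  #asc 1 b (x ∷ xs ++ n ∷ ys)
    ≡⟨ #asc-∷-< 0 (xs ++ n ∷ ys) b<x ⟩
  suc (#asc 1 b (xs ++ n ∷ ys))
    ≡⟨ cong suc (#asc-split 0 xs b<n xs<n ys<n ys<xs) ⟩
  suc (#asc 1 b xs) + 1 + #asc 1 b ys
    ≡⟨ cong (λ k → k + 1 + #asc 1 b ys) (#asc-∷-< 0 xs b<x) ⟨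
  #asc 1 b (x ∷ xs) + 1 + #asc 1 b ys ∎
  where open ≡-Reasoning
#asc-split (suc j) {b} {n} (x ∷ xs) {ys} b<n (x<n ∷ xs<n) ys<n (ys<x ∷ ys<xs) | yes b<x = begin
  #asc (2 + j) b (x ∷ xs ++ n ∷ ys)
    ≡⟨ #asc-∷-< (suc j) (xs ++ n ∷ ys) b<x ⟩
  #asc (suc j) x (xs ++ n ∷ ys) + #asc (2 + j) b (xs ++ n ∷ ys)
    ≡⟨ cong₂ _+_ (#asc-split j xs x<n xs<n ys<n ys<xs) (#asc-split (suc j) xs b<n xs<n ys<n ys<xs) ⟩
  (A₁ + A₀ + #asc (suc j) x ys) + (B₂ + B₁ + C)
    -- Nothing in `ys` can follow `x`, so `ys` is counted only once, in `C`.
    ≡⟨ cong (λ k → (A₁ + A₀ + k) + (B₂ + B₁ + C)) (#asc-none j (All.map ℕ.<⇒≤ ys<x)) ⟩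
  (A₁ + A₀ + 0) + (B₂ + B₁ + C)
    ≡⟨ +-*-Solver.solve 5 (λ a₁ a₀ b₂ b₁ c → let open +-*-Solver in
         (a₁ :+ a₀ :+ con 0) :+ (b₂ :+ b₁ :+ c) := (a₁ :+ b₂) :+ (a₀ :+ b₁) :+ c)
         refl A₁ A₀ B₂ B₁ C ⟩
  (A₁ + B₂) + (A₀ + B₁) + C
    ≡⟨ cong₂ (λ u v → u + v + C) (#asc-∷-< (suc j) xs b<x) (#asc-∷-< j xs b<x) ⟨
  #asc (2 + j) b (x ∷ xs) + #asc (suc j) b (x ∷ xs) + C ∎
  where
  open ≡-Reasoning
  A₁ = #asc (suc j) x xs
  A₀ = #asc j x xs
  B₂ = #asc (2 + j) b xs
  B₁ = #asc (suc j) b xs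
  C  = #asc (2 + j) b ys
#asc-split j {b} {n} (x ∷ xs) {ys} b<n (x<n ∷ xs<n) ys<n (ys<x ∷ ys<xs) | no b≮x = begin
  #asc (suc j) b (x ∷ xs ++ n ∷ ys)
    ≡⟨ #asc-∷-≥ j (xs ++ n ∷ ys) x≤b ⟩
  #asc (suc j) b (xs ++ n ∷ ys)
    ≡⟨ #asc-split j xs b<n xs<n ys<n ys<xs ⟩
  #asc (suc j) b xs + #asc j b xs + #asc (suc j) b ys
    ≡⟨ cong₂ (λ u v → u + v + #asc (suc j) b ys) (#asc-∷-≥ j xs x≤b) (skip j) ⟨
  #asc (suc j) b (x ∷ xs) + #asc j b (x ∷ xs) + #asc (suc j) b ys ∎
  where
  open ≡-Reasoning
  x≤b = ℕ.≮⇒≥ b≮x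
  skip : ∀ j → #asc j b (x ∷ xs) ≡ #asc j b xs
  skip zero    = refl
  skip (suc j) = #asc-∷-≥ j xs x≤b

-- Decomposition of 132-avoiders

-- Pigeonhole: each element of `xs` deletes its own occurrence from `ys`. It serves to determine by
-- counting which letters a word contains.
unique-⊆⇒length≤ : {xs ys : List X} →
  Unique xs → (∀ {x} → x ∈ xs → x ∈ ys) → length xs ≤ length ys
unique-⊆⇒length≤ [] _ = z≤n
unique-⊆⇒length≤ {xs = x ∷ xs} (x∉xs ∷ xs!) xs⊆ys
  with us , vs , refl ← ∈.∈-∃++ (xs⊆ys (here refl)) =
  ℕ.≤-trans (s≤s (unique-⊆⇒length≤ xs! rest)) (ℕ.≤-reflexive (sym (List.length-++-sucʳ us x vs)))
  where
  rest : ∀ {y} → y ∈ xs → y ∈ us ++ vs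
  rest y∈ with ∈.∈-++⁻ us (xs⊆ys (there y∈))
  ... | inj₁ y∈us         = ∈.∈-++⁺ˡ y∈us
  ... | inj₂ (here refl)  = contradiction refl (All.lookup x∉xs y∈)
  ... | inj₂ (there y∈vs) = ∈.∈-++⁺ʳ us y∈vs

unique-map⁺ : {f : X → Y} {xs : List X} →
  (∀ {x y} → x ∈ xs → y ∈ xs → f x ≡ f y → x ≡ y) → Unique xs → Unique (map f xs)
unique-map⁺ inj []          = []
unique-map⁺ inj (x∉xs ∷ xs!) =
  All.map⁺ (All.tabulate λ y∈ eq → All.lookup x∉xs y∈ (inj (here refl) (there y∈) eq)) ∷
  unique-map⁺ (λ x∈ y∈ → inj (there x∈) (there y∈)) xs!

unique-++⁻ : ∀ (xs : List X) {ys} → Unique (xs ++ ys) →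
  Unique xs × Unique ys × (∀ {x y} → x ∈ xs → y ∈ ys → x ≢ y)
unique-++⁻ []       ys!         = [] , ys! , λ ()
unique-++⁻ (x ∷ xs) (x∉ ∷ rest!) with xs! , ys! , xs≢ys ← unique-++⁻ xs rest! =
  All.++⁻ˡ xs x∉ ∷ xs! , ys! , λ where
    (here refl) y∈ → All.lookup (All.++⁻ʳ xs x∉) y∈
    (there x∈)  y∈ → xs≢ys x∈ y∈

⊆-++⁻ : ∀ {w} (xs : List X) {ys} → w ⊆ xs ++ ys → ∃₂ λ u v → w ≡ u ++ v × u ⊆ xs × v ⊆ ys
⊆-++⁻ []       τ          = [] , _ , refl , [] , τ
⊆-++⁻ (x ∷ xs) (.x ∷ʳ τ)  with u , v , eq , σ , ρ ← ⊆-++⁻ xs τ = u , v , eq , x ∷ʳ σ , ρ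
⊆-++⁻ (x ∷ xs) (refl ∷ τ) with u , v , refl , σ , ρ ← ⊆-++⁻ xs τ =
  x ∷ u , v , refl , refl ∷ σ , ρ

-- The first occurrence of `n` marks the cut in both decompositions.
++-∷-injective : ∀ {n : X} xs {xs′ ys ys′} → n ∉ xs → n ∉ xs′ →
  xs ++ n ∷ ys ≡ xs′ ++ n ∷ ys′ → xs ≡ xs′ × ys ≡ ys′
++-∷-injective []       {[]}      _  _   refl = refl , refl
++-∷-injective []       {x ∷ xs′} _  n∉′ refl = contradiction (here refl) n∉′
++-∷-injective (x ∷ xs) {[]}      n∉ _   refl = contradiction (here refl) n∉
++-∷-injective (x ∷ xs) {y ∷ xs′} n∉ n∉′ eq
  with refl , eq′ ← List.∷-injective eq
  with refl , refl ← ++-∷-injective xs (n∉ ∘ there) (n∉′ ∘ there) eq′ = refl , refl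

∈-wordsOver⁻ : ∀ as l {w} → w ∈ wordsOver as l → length w ≡ l × All (_∈ as) w
∈-wordsOver⁻ as zero    (here refl) = refl , []
∈-wordsOver⁻ as (suc l) w∈
  with a , u , a∈ , u∈ , refl ← ∈.∈-cartesianProductWith⁻ _∷_ as (wordsOver as l) w∈
  with |u| , u∈as ← ∈-wordsOver⁻ as l u∈ = cong suc |u| , a∈ ∷ u∈as

∈-wordsOver⁺ : ∀ {as w} → All (_∈ as) w → w ∈ wordsOver as (length w)
∈-wordsOver⁺ []        = here refl
∈-wordsOver⁺ (a∈ ∷ w∈) = ∈.∈-cartesianProductWith⁺ _∷_ a∈ (∈-wordsOver⁺ w∈)

unique-wordsOver : ∀ {as} l → Unique as → Unique (wordsOver as l)
unique-wordsOver zero    as! = [] ∷ []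
unique-wordsOver (suc l) as! =
  Unique.cartesianProductWith⁺ _∷_ List.∷-injective as! (unique-wordsOver l as!)

unique-oneTo : ∀ n → Unique (oneTo n)
unique-oneTo n = Unique.applyUpTo⁺₁ suc n λ i<j _ → ℕ.<⇒≢ i<j ∘ ℕ.suc-injective

∈-oneTo⁺ : ∀ {n a} → 0 < a → a ≤ n → a ∈ oneTo n
∈-oneTo⁺ {a = suc a} _ a≤n = ∈.∈-applyUpTo⁺ suc a≤n

∈-oneTo⁻ : ∀ {n a} → a ∈ oneTo n → 0 < a × a ≤ n
∈-oneTo⁻ a∈ with _ , i<n , refl ← ∈.∈-applyUpTo⁻ suc a∈ = z<s , i<n

-- Membership in `𝒮132 n`, with the pattern expressed by the order of the letters instead of by
-- `red`. That every letter of `oneTo n` occurs follows by counting in `∈-avoider`.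
record Avoider (n : ℕ) (σ : Word) : Set where
  field
    length≡ : length σ ≡ n
    letters : ∀ {a} → a ∈ σ → 0 < a × a ≤ n
    unique  : Unique σ
    avoids  : ∀ {a b c} → a ∷ b ∷ c ∷ [] ⊆ σ → a < c → ¬ c < b

open Avoider

red≡132⇒ : ∀ {a b c} → red (a ∷ b ∷ c ∷ []) ≡ 1 ∷ 3 ∷ 2 ∷ [] → a < c × c < b
red≡132⇒ {a} {b} {c} eq with rank-c , eq′ ← List.∷-injective (List.∷-injectiveʳ eq) =
  smaller (List.∷-injectiveˡ eq) (List.∷-injectiveˡ eq′) ℕ.≤-refl ,
  smaller (List.∷-injectiveˡ eq′) rank-c ℕ.≤-refl
  where
  smaller : ∀ {x y i j} →
    rank (a ∷ b ∷ c ∷ []) x ≡ i → rank (a ∷ b ∷ c ∷ []) y ≡ j → i < j → x < y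
  smaller refl refl i<j = ℕ.≰⇒> (ℕ.<⇒≱ i<j ∘ rank-mono (a ∷ b ∷ c ∷ []))

⇒red≡132 : ∀ {a b c} → a < c → c < b → red (a ∷ b ∷ c ∷ []) ≡ 1 ∷ 3 ∷ 2 ∷ []
⇒red≡132 {a} {b} {c} a<c c<b
  -- Three comparisons for each of the ranks of `a`, `b` and `c`, in that order.
  rewrite rank-accept (b ∷ c ∷ []) (ℕ.≤-refl {a})
        | rank-reject (c ∷ []) (ℕ.<-trans a<c c<b)
        | rank-reject [] a<c
        | rank-accept (b ∷ c ∷ []) (ℕ.<⇒≤ (ℕ.<-trans a<c c<b))
        | rank-accept (c ∷ []) (ℕ.≤-refl {b})
        | rank-accept [] (ℕ.<⇒≤ c<b)
        | rank-accept (b ∷ c ∷ []) (ℕ.<⇒≤ a<c)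
        | rank-reject (c ∷ []) c<b
        | rank-accept [] (ℕ.≤-refl {c})
  = refl

∈-𝒮132⁻ : ∀ {n σ} → σ ∈ 𝒮132 n → Avoider n σ
∈-𝒮132⁻ {n} {σ} σ∈
  with σ∈𝒮 , occr≡0 ← ∈.∈-filter⁻ (λ σ → occr (1 ∷ 3 ∷ 2 ∷ []) σ ℕ.≟ 0) {xs = 𝒮 n} σ∈
  with σ∈words , σ! ← ∈.∈-filter⁻ (Unique.unique? ℕ._≟_) {xs = wordsOver (oneTo n) n} σ∈𝒮
  with |σ| , σ⊆ ← ∈-wordsOver⁻ (oneTo n) n σ∈words = record
  { length≡ = |σ|
  ; letters = ∈-oneTo⁻ ∘ All.lookup σ⊆
  ; unique  = σ!
  -- A 132 in `σ` would be an element of the filtered list whose length is `occr`, which is 0.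
  ; avoids  = λ τ a<c c<b → ℕ.<⇒≢ (∈.∈-length (∈.∈-filter⁺ (λ w → List.≡-dec ℕ._≟_ (red w) _)
                (∈-subwords⁺ τ) (⇒red≡132 a<c c<b))) (sym occr≡0)
  }

∈-𝒮132⁺ : ∀ {n σ} → Avoider n σ → σ ∈ 𝒮132 n
∈-𝒮132⁺ {σ = σ} A with refl ← length≡ A =
  ∈.∈-filter⁺ (λ σ → occr (1 ∷ 3 ∷ 2 ∷ []) σ ℕ.≟ 0)
    (∈.∈-filter⁺ (Unique.unique? ℕ._≟_)
      (∈-wordsOver⁺ (All.tabulate (uncurry ∈-oneTo⁺ ∘ letters A))) (unique A))
    (cong length (List.filter-none (λ w → List.≡-dec ℕ._≟_ (red w) (1 ∷ 3 ∷ 2 ∷ []))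
      (All.tabulate λ {w} → no-132 {w})))
  where
  no-132 : ∀ {w} → w ∈ subwords 3 σ → ¬ red w ≡ 1 ∷ 3 ∷ 2 ∷ []
  no-132 w∈ eq with ∈-subwords⁻ 3 σ w∈
  no-132 {a ∷ b ∷ c ∷ []} w∈ eq | τ , refl = uncurry (avoids A τ) (red≡132⇒ eq)

unique-𝒮132 : ∀ n → Unique (𝒮132 n)
unique-𝒮132 n = Unique.filter⁺ (λ σ → occr (1 ∷ 3 ∷ 2 ∷ []) σ ℕ.≟ 0)
  (Unique.filter⁺ (Unique.unique? ℕ._≟_) (unique-wordsOver n (unique-oneTo n)))

-- Were `a` absent, `a ∷ σ` would consist of `suc n` distinct letters of `oneTo n`.
∈-avoider : ∀ {n σ a} → Avoider n σ → 0 < a → a ≤ n → a ∈ σ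
∈-avoider {n} {σ} {a} A 0<a a≤n = decidable-stable (_∈?_ ℕ._≟_ a σ) λ a∉σ →
  ℕ.<-irrefl refl (begin-strict
    length σ         ≡⟨ length≡ A ⟩
    n                <⟨ ℕ.≤-refl ⟩
    suc n            ≡⟨ cong suc (length≡ A) ⟨
    length (a ∷ σ)   ≤⟨ unique-⊆⇒length≤ (All.¬Any⇒All¬ σ a∉σ ∷ unique A) bounded ⟩
    length (oneTo n) ≡⟨ List.length-applyUpTo suc n ⟩
    n                ≡⟨ length≡ A ⟨
    length σ         ∎)
  where
  open ℕ.≤-Reasoning
  bounded : ∀ {x} → x ∈ a ∷ σ → x ∈ oneTo n
  bounded (here refl) = ∈-oneTo⁺ 0<a a≤n
  bounded (there x∈)  = uncurry ∈-oneTo⁺ (letters A x∈)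

join : Word × Word → Word
join (α , β) = map (length β +_) α ++ suc (length α + length β) ∷ β

join-bounds : ∀ {k l α β} → Avoider k α → Avoider l β →
  (∀ {a} → a ∈ map (length β +_) α → length β < a × a < suc (length α + length β)) ×
  (∀ {b} → b ∈ β → b ≤ length β)
join-bounds {α = α} {β} A B with refl ← length≡ A | refl ← length≡ B = above , proj₂ ∘ letters B
  where
  above : ∀ {a} → a ∈ map (length β +_) α → length β < a × a < suc (length α + length β)
  above a∈ with x , x∈ , refl ← ∈.∈-map⁻ (length β +_) a∈ with 0<x , x≤ ← letters A x∈ =
    ℕ.m<m+n (length β) 0<x ,
    s≤s (ℕ.≤-trans (ℕ.+-monoʳ-≤ (length β) x≤) (ℕ.≤-reflexive (ℕ.+-comm (length β) _)))

⊆-map⁻ : (f : X → Y) (xs : List X) {ys : List Y} → ys ⊆ map f xs →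
  ∃ λ zs → zs ⊆ xs × ys ≡ map f zs
⊆-map⁻ f []       []         = [] , [] , refl
⊆-map⁻ f (x ∷ xs) (_ ∷ʳ τ)   with zs , ρ , refl ← ⊆-map⁻ f xs τ = zs , x ∷ʳ ρ , refl
⊆-map⁻ f (x ∷ xs) (refl ∷ τ) with zs , ρ , refl ← ⊆-map⁻ f xs τ = x ∷ zs , refl ∷ ρ , refl

-- The letters fall in three disjoint ranges: up to `length β`, strictly between `length β` and the
-- maximum, and the maximum itself. A 132 cannot be spread over them, so it would lie within one
-- factor.
join-avoider : ∀ {k l α β} → Avoider k α → Avoider l β → Avoider (suc (k + l)) (join (α , β))
join-avoider {α = α} {β} A B with refl ← length≡ A | refl ← length≡ B
  with α-bounds , β-bound ← join-bounds A B = record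
  { length≡ = begin
      length (map (l +_) α ++ n ∷ β)       ≡⟨ List.length-++ (map (l +_) α) ⟩
      length (map (l +_) α) + suc l        ≡⟨ cong (_+ suc l) (List.length-map (l +_) α) ⟩
      length α + suc l                     ≡⟨ ℕ.+-suc (length α) l ⟩
      n                                    ∎
  ; letters = joined-letters
  ; unique  = Unique.++⁺ (Unique.map⁺ (ℕ.+-cancelˡ-≡ l _ _) (unique A))
      (All.tabulate (λ b∈ → ℕ.>⇒≢ (s≤s (ℕ.≤-trans (β-bound b∈) (ℕ.m≤n+m l (length α))))) ∷ unique B)
      λ where
        (a∈ , here refl) → ℕ.<-irrefl refl (proj₂ (α-bounds a∈))
        (a∈ , there b∈)  → ℕ.<⇒≱ (proj₁ (α-bounds a∈)) (β-bound b∈)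
  ; avoids  = joined-avoids
  }
  where
  open ≡-Reasoning
  l = length β
  n = suc (length α + l)
  joined-letters : ∀ {a} → a ∈ join (α , β) → 0 < a × a ≤ n
  joined-letters a∈ with ∈.∈-++⁻ (map (l +_) α) a∈
  ... | inj₁ a∈α with l<a , a<n ← proj₁ (join-bounds A B) a∈α = ℕ.≤-<-trans z≤n l<a , ℕ.<⇒≤ a<n
  ... | inj₂ (here refl) = z<s , ℕ.≤-refl
  ... | inj₂ (there a∈β) with 0<a , a≤l ← letters B a∈β =
    0<a , ℕ.m≤n⇒m≤1+n (ℕ.≤-trans a≤l (ℕ.m≤n+m l (length α)))

  -- 132 cannot have its 1 left of n and its 2 at n or further right.
  no-straddle : ∀ {a b c v} → a ∈ map (l +_) α → v ⊆ n ∷ β → c ∈ v → b ≤ n → a < c → ¬ c < b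
  no-straddle a∈ τ c∈ b≤n a<c c<b with ⊆.Any-resp-⊆ τ c∈
  ... | here refl = ℕ.<⇒≱ c<b b≤n
  ... | there c∈β =
    ℕ.≤⇒≯ (proj₂ (letters B c∈β)) (ℕ.<-trans (proj₁ (proj₁ (join-bounds A B) a∈)) a<c)

  joined-avoids : ∀ {a b c} → a ∷ b ∷ c ∷ [] ⊆ join (α , β) → a < c → ¬ c < b
  joined-avoids τ a<c c<b
    with b≤n ← proj₂ (joined-letters (⊆.Any-resp-⊆ τ (there (here refl))))
    -- Cases by how many letters of the pattern stand left of `n`. With none, `n` cannot be the 1;
    -- with all three, cancelling the shift gives a 132 in `α`.
    with ⊆-++⁻ (map (l +_) α) τ
  ... | [] , _ , refl , _ , _ ∷ʳ ρ = avoids B ρ a<c c<b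
  ... | [] , _ , refl , _ , refl ∷ ρ = ℕ.<⇒≱ a<c
    (ℕ.m≤n⇒m≤1+n (ℕ.m≤n⇒m≤o+n (length α) (proj₂ (letters B (⊆.Any-resp-⊆ ρ (there (here refl)))))))
  ... | _ ∷ [] , _ , refl , π , ρ =
    no-straddle (⊆.Any-resp-⊆ π (here refl)) ρ (there (here refl)) b≤n a<c c<b
  ... | _ ∷ _ ∷ [] , _ , refl , π , ρ =
    no-straddle (⊆.Any-resp-⊆ π (here refl)) ρ (here refl) b≤n a<c c<b
  ... | _ ∷ _ ∷ _ ∷ [] , _ , refl , π , ρ with ⊆-map⁻ (l +_) α π
  ...   | _ ∷ _ ∷ _ ∷ [] , ρ′ , refl =
    avoids A ρ′ (ℕ.+-cancelˡ-< l _ _ a<c) (ℕ.+-cancelˡ-< l _ _ c<b)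

-- The word is cut at its maximum. Avoidance puts all of `ys` below all of `xs`; counting then shows
-- that `ys` uses exactly the letters up to `l` and `xs` only larger ones, so `α` is `xs` shifted
-- down.
split-avoider : ∀ {n σ} → Avoider (suc n) σ →
  ∃₂ λ α β → σ ≡ join (α , β) × length α + length β ≡ n ×
    Avoider (length α) α × Avoider (length β) β
split-avoider {n} A with xs , ys , refl ← ∈.∈-∃++ (∈-avoider A z<s ℕ.≤-refl)
  with xs! , n∉ys ∷ ys! , xs≢ ← unique-++⁻ xs (unique A) = α , ys ,
  cong₂ (λ u k → u ++ suc k ∷ ys) (sym shift-α) (sym |α|+|ys|) , |α|+|ys| ,
  record
    { length≡ = refl
    ; letters = α-letters
    ; unique  = Unique.map⁻ (subst Unique (sym shift-α) xs!)
    ; avoids  = λ {a} {b} {c} τ a<c c<b → avoids A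
        (⊆.++⁺ʳ (suc n ∷ ys) (subst (map (l +_) (a ∷ b ∷ c ∷ []) ⊆_) shift-α (⊆.map⁺ (l +_) τ)))
        (ℕ.+-monoʳ-< l a<c) (ℕ.+-monoʳ-< l c<b)
    } ,
  record
    { length≡ = refl
    ; letters = λ y∈ → proj₁ (letters A (∈.∈-++⁺ʳ xs (there y∈))) , ys≤ y∈
    ; unique  = ys!
    ; avoids  = λ τ → avoids A (⊆.++⁺ˡ xs (suc n ∷ʳ τ))
    }
  where
  l = length ys
  α = map (_∸ l) xs

  xs≤n : ∀ {x} → x ∈ xs → x ≤ n
  xs≤n x∈ = s≤s⁻¹ (ℕ.≤∧≢⇒< (proj₂ (letters A (∈.∈-++⁺ˡ x∈))) (xs≢ x∈ (here refl)))

  ys≤n : ∀ {y} → y ∈ ys → y ≤ n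
  ys≤n y∈ = s≤s⁻¹ (ℕ.≤∧≢⇒< (proj₂ (letters A (∈.∈-++⁺ʳ xs (there y∈)))) (All.lookup n∉ys y∈ ∘ sym))

  ys<xs : ∀ {x y} → x ∈ xs → y ∈ ys → y < x
  ys<xs x∈ y∈ = ℕ.≤∧≢⇒<
    -- With `x < y` the letters `x`, `suc n`, `y` would form a 132.
    (ℕ.≮⇒≥ λ x<y → avoids A (⊆.++⁺ (from∈ x∈) (refl ∷ from∈ y∈)) x<y (s≤s (ys≤n y∈)))
    (xs≢ x∈ (there y∈) ∘ sym)

  -- All of 1, …, y are to the right of the maximum.
  ys≤ : ∀ {y} → y ∈ ys → y ≤ l
  ys≤ {y} y∈ = subst (_≤ l) (List.length-applyUpTo suc y) (unique-⊆⇒length≤ (unique-oneTo y) below)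
    where
    below : ∀ {z} → z ∈ oneTo y → z ∈ ys
    below z∈ with 0<z , z≤y ← ∈-oneTo⁻ z∈
      with ∈.∈-++⁻ xs (∈-avoider A 0<z (ℕ.m≤n⇒m≤1+n (ℕ.≤-trans z≤y (ys≤n y∈))))
    ... | inj₁ z∈xs         = contradiction (ys<xs z∈xs y∈) (ℕ.≤⇒≯ z≤y)
    ... | inj₂ (here refl)  = contradiction (ys≤n y∈) (ℕ.<⇒≱ z≤y)
    ... | inj₂ (there z∈ys) = z∈ys

  -- The `l` distinct letters of `ys` are positive and smaller than the given letter of `xs`.
  xs> : ∀ {x} → x ∈ xs → l < x
  xs> {zero}  x∈ = contradiction (proj₁ (letters A (∈.∈-++⁺ˡ x∈))) λ ()
  xs> {suc x} x∈ = s≤s (subst (l ≤_) (List.length-applyUpTo suc x) (unique-⊆⇒length≤ ys! λ y∈ →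
    ∈-oneTo⁺ (proj₁ (letters A (∈.∈-++⁺ʳ xs (there y∈)))) (s≤s⁻¹ (ys<xs x∈ y∈))))

  -- The truncated subtraction in `α` loses nothing, since every letter of `xs` exceeds `l`.
  shift-α : map (l +_) α ≡ xs
  shift-α = trans (sym (List.map-∘ xs))
    (List.map-id-local (All.tabulate (ℕ.m+[n∸m]≡n ∘ ℕ.<⇒≤ ∘ xs>)))

  |α|+|ys| : length α + l ≡ n
  |α|+|ys| = ℕ.suc-injective (begin
    suc (length α + l)      ≡⟨ cong (λ k → suc (k + l)) (List.length-map (_∸ l) xs) ⟩
    suc (length xs + l)     ≡⟨ ℕ.+-suc (length xs) l ⟨
    length xs + suc l       ≡⟨ List.length-++ xs ⟨
    length (xs ++ suc n ∷ ys) ≡⟨ length≡ A ⟩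
    suc n ∎)
    where open ≡-Reasoning

  α-letters : ∀ {a} → a ∈ α → 0 < a × a ≤ length α
  α-letters a∈ with x , x∈ , refl ← ∈.∈-map⁻ (_∸ l) a∈ =
    ℕ.m<n⇒0<n∸m (xs> x∈) , ℕ.m≤n+o⇒m∸n≤o x l
      (ℕ.≤-trans (xs≤n x∈) (ℕ.≤-reflexive (trans (sym |α|+|ys|) (ℕ.+-comm _ l))))

-- The bijection between avoiders and pairs of avoiders

pairsAt : ℕ → ℕ → List (Word × Word)
pairsAt n i = cartesianProduct (𝒮132 i) (𝒮132 (n ∸ i))

-- The blocks are ordered by the length of the left factor, like the summands of the recurrence, so
-- that `expand` is an equality of lists.
pairs : ℕ → List (Word × Word)
pairs n = concat (applyUpTo (pairsAt n) (suc n))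

∈-pairs⁻ : ∀ {n α β} → (α , β) ∈ pairs n →
  length α + length β ≡ n × Avoider (length α) α × Avoider (length β) β
∈-pairs⁻ {n} {α} {β} αβ∈ with ∈.∈-concat⁻′ (applyUpTo (pairsAt n) (suc n)) αβ∈
... | _ , αβ∈′ , block∈ with i , i<1+n , refl ← ∈.∈-applyUpTo⁻ (pairsAt n) block∈
  with α∈ , β∈ ← ∈.∈-cartesianProduct⁻ (𝒮132 i) (𝒮132 (n ∸ i)) αβ∈′
  with A ← ∈-𝒮132⁻ {i} α∈ | B ← ∈-𝒮132⁻ {n ∸ i} β∈
  = trans (cong₂ _+_ (length≡ A) (length≡ B)) (ℕ.m+[n∸m]≡n (s≤s⁻¹ i<1+n)) ,
    subst (λ k → Avoider k α) (sym (length≡ A)) A ,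
    subst (λ k → Avoider k β) (sym (length≡ B)) B

∈-pairs⁺ : ∀ {α β} → Avoider (length α) α → Avoider (length β) β →
  (α , β) ∈ pairs (length α + length β)
∈-pairs⁺ {α} {β} A B = ∈.∈-concat⁺′
  (∈.∈-cartesianProduct⁺ (∈-𝒮132⁺ A)
    (subst (λ k → β ∈ 𝒮132 k) (sym (ℕ.m+n∸m≡n (length α) (length β))) (∈-𝒮132⁺ B)))
  (∈.∈-applyUpTo⁺ (pairsAt (length α + length β)) (s≤s (ℕ.m≤m+n (length α) (length β))))

-- Distinct blocks are disjoint because the length of the left factor recovers the block index.
unique-pairs : ∀ n → Unique (pairs n)
unique-pairs n = Unique.concat⁺
  (All.applyUpTo⁺₂ (pairsAt n) (suc n) λ i →
    Unique.cartesianProduct⁺ (unique-𝒮132 i) (unique-𝒮132 (n ∸ i)))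
  (AllPairs.applyUpTo⁺₁ (pairsAt n) (suc n) λ i<j _ (∈ᵢ , ∈ⱼ) →
    ℕ.<⇒≢ i<j (trans (sym (left-length ∈ᵢ)) (left-length ∈ⱼ)))
  where
  left-length : ∀ {i αβ} → αβ ∈ pairsAt n i → length (proj₁ αβ) ≡ i
  left-length {i} αβ∈ =
    length≡ (∈-𝒮132⁻ (proj₁ (∈.∈-cartesianProduct⁻ (𝒮132 i) (𝒮132 (n ∸ i)) αβ∈)))

max∉left : ∀ {n α β} → length α + length β ≡ n → Avoider (length α) α → Avoider (length β) β →
  suc n ∉ map (length β +_) α
max∉left refl A B n∈ = ℕ.<-irrefl refl (proj₂ (proj₁ (join-bounds A B) n∈))

-- In both words `suc n` marks the cut. The right factors then agree, hence so do the shifts, which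
-- cancel on the left.
join-injective : ∀ {n p q} → p ∈ pairs n → q ∈ pairs n → join p ≡ join q → p ≡ q
join-injective {n} {p = α , β} {α′ , β′} p∈ q∈ eq
  with |αβ| , A , B ← ∈-pairs⁻ {n} p∈ | |αβ|′ , A′ , B′ ← ∈-pairs⁻ {n} q∈
  with same , refl ← ++-∷-injective (map (length β +_) α) (max∉left |αβ| A B) (max∉left |αβ|′ A′ B′)
        (trans (cong (λ k → map (length β +_) α ++ suc k ∷ β) (sym |αβ|))
               (trans eq (cong (λ k → map (length β′ +_) α′ ++ suc k ∷ β′) |αβ|′)))
  = cong (_, β) (List.map-injective (ℕ.+-cancelˡ-≡ (length β) _ _) same)

-- Two duplicate-free lists with the same members are permutations of each other; `split-avoider`
-- and `join-avoider` give the two inclusions.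
𝒮132-↭ : ∀ n → 𝒮132 (suc n) ↭ map join (pairs n)
𝒮132-↭ n = ∼bag⇒↭ (unique∧set⇒bag (unique-𝒮132 (suc n))
  (unique-map⁺ (join-injective {n}) (unique-pairs n)) (mk⇔ to from))
  where
  to : ∀ {σ} → σ ∈ 𝒮132 (suc n) → σ ∈ map join (pairs n)
  to σ∈ with α , β , refl , refl , A , B ← split-avoider (∈-𝒮132⁻ {suc n} σ∈) =
    ∈.∈-map⁺ join (∈-pairs⁺ A B)
  from : ∀ {σ} → σ ∈ map join (pairs n) → σ ∈ 𝒮132 (suc n)
  from σ∈ with (α , β) , p∈ , refl ← ∈.∈-map⁻ join {xs = pairs n} σ∈
    with refl , A , B ← ∈-pairs⁻ {n} p∈ =
    ∈-𝒮132⁺ (join-avoider A B)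

-- This is `#asc-split` with lower bound 0; by `occr-shift` the shift of `α` leaves its counts
-- unchanged.
occr-join : ∀ {k l α β} → Avoider k α → Avoider l β → ∀ j → occr (oneTo (suc j)) (join (α , β)) ≡
  occr (oneTo (suc j)) α + occr (oneTo j) α + occr (oneTo (suc j)) β
occr-join {α = α} {β} A B j with above , below ← join-bounds A B = begin
  occr (oneTo (suc j)) (join (α , β))
    ≡⟨ occr-oneTo (suc j) (All.tabulate (proj₁ ∘ letters (join-avoider A B))) ⟩
  #asc (suc j) 0 (join (α , β))
    ≡⟨ #asc-split j α′ z<s (All.tabulate (proj₂ ∘ above))
         (All.tabulate λ b∈ → s≤s (ℕ.≤-trans (below b∈) (ℕ.m≤n+m (length β) (length α))))
         (All.tabulate λ a∈ → All.tabulate λ b∈ → ℕ.≤-<-trans (below b∈) (proj₁ (above a∈))) ⟩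
  #asc (suc j) 0 α′ + #asc j 0 α′ + #asc (suc j) 0 β
    ≡⟨ cong₂ _+_ (cong₂ _+_ (unshift (suc j)) (unshift j))
         (sym (occr-oneTo (suc j) (All.tabulate (proj₁ ∘ letters B)))) ⟩
  occr (oneTo (suc j)) α + occr (oneTo j) α + occr (oneTo (suc j)) β ∎
  where
  open ≡-Reasoning
  α′ = map (length β +_) α
  unshift : ∀ i → #asc i 0 α′ ≡ occr (oneTo i) α
  unshift i = trans
    (sym (occr-oneTo i (All.tabulate (ℕ.≤-<-trans z≤n ∘ proj₁ ∘ proj₁ (join-bounds A B)))))
    (occr-shift (oneTo i) (length β) α)

-- At `j = 1` the middle term of `occr-join` is therefore the length of `α`, the source of the power
-- of x₂.
occr-1 : ∀ {k α} → Avoider k α → occr (oneTo 1) α ≡ k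
occr-1 A = trans (trans (occr-oneTo 1 0<α) (#asc-1 0<α)) (length≡ A)
  where 0<α = All.tabulate (proj₁ ∘ letters A)

-- Polynomials and series

↭⇒≈ : {p q : Poly v} → p ↭ q → p ≈ q
↭⇒≈ p↭q e = ↭ₛ.foldr-commMonoid (setoid ℤ) ℤ.+-0-isCommutativeMonoid
  (↭⇒↭ₛ (↭.map⁺ proj₁ (↭.filter-↭ (λ t → Vec.≡-dec ℕ._≟_ (proj₂ t) e) p↭q)))

≡⇒≈ : {p q : Poly v} → p ≡ q → p ≈ q
≡⇒≈ refl e = refl

*ₚ-identityˡ : (p : Poly v) → 1ₚ *ₚ p ≡ p
*ₚ-identityˡ p = trans (List.++-identityʳ _) (List.map-id-local (All.universal
  (λ (c , e) → cong₂ _,_ (ℤ.*-identityˡ c) (Vec.zipWith-identityˡ ℕ.+-identityˡ e)) p))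

*ₚ-zeroʳ : (p : Poly v) → p *ₚ 0ₚ ≡ 0ₚ
*ₚ-zeroʳ = List.cartesianProductWith-zeroʳ _

infixl 6 _⊕_
_⊕_ : Vec ℕ v → Vec ℕ v → Vec ℕ v
_⊕_ = zipWith _+_

infixr 7 _⊙_
_⊙_ : ℕ → Vec ℕ v → Vec ℕ v
k ⊙ e = Vec.map (k *_) e

-- The generating polynomial of a statistic `f` over a list. Both sides of the recurrence take this
-- form, which reduces their comparison to lists of words.
monomials : (X → Vec ℕ v) → List X → Poly v
monomials f = map (λ x → 1ℤ , f x)

-- `_*ₚ_` and `cartesianProduct` enumerate pairs in the same order, hence `≡` rather than `≈`.
monomials-* : (f : X → Vec ℕ v) (g : Y → Vec ℕ v) (xs : List X) (ys : List Y) →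
  monomials f xs *ₚ monomials g ys ≡ monomials (λ (x , y) → f x ⊕ g y) (cartesianProduct xs ys)
monomials-* f g []       ys = refl
monomials-* f g (x ∷ xs) ys = begin
  map _ (monomials g ys) ++ monomials f xs *ₚ monomials g ys
    ≡⟨ cong₂ _++_ (trans (sym (List.map-∘ ys)) (List.map-∘ ys)) (monomials-* f g xs ys) ⟩
  monomials h (map (x ,_) ys) ++ monomials h (cartesianProduct xs ys)
    ≡⟨ List.map-++ _ (map (x ,_) ys) (cartesianProduct xs ys) ⟨
  monomials h (map (x ,_) ys ++ cartesianProduct xs ys) ∎
  where
  open ≡-Reasoning
  h = λ (x , y) → f x ⊕ g y

monomial-*-monomials : (u : Vec ℕ v) (f : X → Vec ℕ v) (xs : List X) →
  monomial u *ₚ monomials f xs ≡ monomials (λ x → u ⊕ f x) xs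
monomial-*-monomials u f xs = trans (List.++-identityʳ _) (sym (List.map-∘ xs))

monomial-^ : (u : Vec ℕ v) (k : ℕ) → monomial u ^ₚ k ≡ monomial (k ⊙ u)
monomial-^ u zero    = cong monomial (sym (Vec.map-const u 0))
monomial-^ u (suc k) = trans (cong (monomial u *ₚ_) (monomial-^ u k)) (cong monomial (add u))
  where
  add : ∀ {v} (u : Vec ℕ v) → u ⊕ k ⊙ u ≡ suc k ⊙ u
  add []      = refl
  add (x ∷ u) = cong (_ ∷_) (add u)

-- mergeExp and linComb mirror, on exponents, mergeNext and the evaluation of a monomial at monomials.
mergeExp : Vec (Vec ℕ v) d → Vec (Vec ℕ v) d
mergeExp []           = []
mergeExp (u ∷ [])     = u ∷ []
mergeExp (u ∷ w ∷ us) = u ⊕ w ∷ mergeExp (w ∷ us)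

linComb : Vec (Vec ℕ v) d → Vec ℕ d → Vec ℕ v
linComb us e = Vec.foldr′ _⊕_ (replicate _ 0) (zipWith (λ u k → k ⊙ u) us e)

mergeNext-monomial : (us : Vec (Vec ℕ v) d) →
  mergeNext (Vec.map monomial us) ≡ Vec.map monomial (mergeExp us)
mergeNext-monomial []           = refl
mergeNext-monomial (u ∷ [])     = refl
mergeNext-monomial (u ∷ w ∷ us) = cong (_ ∷_) (mergeNext-monomial (w ∷ us))

monomial-product : (us : Vec (Vec ℕ v) d) (e : Vec ℕ d) →
  Vec.foldr′ _*ₚ_ 1ₚ (zipWith _^ₚ_ (Vec.map monomial us) e) ≡ monomial (linComb us e)
monomial-product []       []      = refl
monomial-product (u ∷ us) (k ∷ e) = cong₂ _*ₚ_ (monomial-^ u k) (monomial-product us e)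

⟨⟩-monomials : (us : Vec (Vec ℕ w) v) (f : X → Vec ℕ v) (xs : List X) →
  monomials f xs ⟨ Vec.map monomial us ⟩ ≡ monomials (linComb us ∘ f) xs
⟨⟩-monomials us f []       = refl
⟨⟩-monomials us f (x ∷ xs) = cong₂ _++_
  (trans (*ₚ-identityˡ _) (monomial-product us (f x))) (⟨⟩-monomials us f xs)

basis : ∀ v → Vec (Vec ℕ v) v
basis v = tabulate λ i → replicate v 0 Vec.[ i ]≔ 1

vars-basis : ∀ v → vars v ≡ Vec.map monomial (basis v)
vars-basis v = Vec.tabulate-∘ monomial _

-- carry 0 is the effect of x_i ↦ x_i x_{i+1} on exponents; a carry of c multiplies by x₂^c.
carry : ℕ → Vec ℕ v → Vec ℕ v
carry c []      = []
carry c (k ∷ e) = c + k ∷ carry k e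

⊙-zeroʳ : ∀ k v → k ⊙ replicate v 0 ≡ replicate v 0
⊙-zeroʳ k v = trans (Vec.map-replicate (k *_) 0 v) (cong (replicate v) (ℕ.*-zeroʳ k))

mergeExp-0∷ : (us : Vec (Vec ℕ v) d) → mergeExp (Vec.map (0 ∷_) us) ≡ Vec.map (0 ∷_) (mergeExp us)
mergeExp-0∷ []           = refl
mergeExp-0∷ (u ∷ [])     = refl
mergeExp-0∷ (u ∷ w ∷ us) = cong (_ ∷_) (mergeExp-0∷ (w ∷ us))

linComb-0∷ : (us : Vec (Vec ℕ v) d) (e : Vec ℕ d) → linComb (Vec.map (0 ∷_) us) e ≡ 0 ∷ linComb us e
linComb-0∷ []       []      = refl
linComb-0∷ (u ∷ us) (k ∷ e) rewrite linComb-0∷ us e | ℕ.*-zeroʳ k = refl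

first : ∀ v → Vec ℕ (suc v)
first v = 1 ∷ replicate v 0

basis-suc : ∀ v → basis (suc v) ≡ first v ∷ Vec.map (0 ∷_) (basis v)
basis-suc v = cong (first v ∷_) (Vec.tabulate-∘ (0 ∷_) _)

-- The first exponent `k` counts for the first variable and for the next one. In the first it is
-- added to `c`; in the next it is the carry into the remaining exponents, so induction applies with
-- `k` in place of `c`. The last variable passes nothing on.
carry-linComb : ∀ c (e : Vec ℕ (suc v)) →
  c ⊙ first v ⊕ linComb (mergeExp (basis (suc v))) e ≡ carry c e
carry-linComb {zero}  c (k ∷ []) rewrite ℕ.*-identityʳ c | ℕ.*-identityʳ k | ℕ.+-identityʳ k = refl
carry-linComb {suc v} c (k ∷ e) = begin
  c ⊙ first (suc v) ⊕ linComb (mergeExp (basis (2 + v))) (k ∷ e)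
    ≡⟨ cong (λ us → c ⊙ first (suc v) ⊕ linComb (mergeExp us) (k ∷ e)) (basis-suc (suc v)) ⟩
  c ⊙ first (suc v) ⊕ (k ⊙ (1 ∷ 𝟘 ⊕ first v) ⊕ linComb (mergeExp (Vec.map (0 ∷_) us)) e)
    ≡⟨ cong (λ u → c ⊙ first (suc v) ⊕ (k ⊙ (1 ∷ 𝟘 ⊕ first v) ⊕ u))
         (trans (cong (λ us → linComb us e) (mergeExp-0∷ us)) (linComb-0∷ (mergeExp us) e)) ⟩
  c * 1 + (k * 1 + 0) ∷ c ⊙ 𝟘 ⊕ (k ⊙ (𝟘 ⊕ first v) ⊕ linComb (mergeExp us) e)
    ≡⟨ cong₂ _∷_
         (cong₂ _+_ (ℕ.*-identityʳ c) (trans (ℕ.+-identityʳ _) (ℕ.*-identityʳ k)))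
         (trans (cong₂ _⊕_ (⊙-zeroʳ c (suc v)) (cong (λ u → k ⊙ u ⊕ linComb (mergeExp us) e)
                  (Vec.zipWith-identityˡ ℕ.+-identityˡ (first v))))
                (Vec.zipWith-identityˡ ℕ.+-identityˡ _)) ⟩
  c + k ∷ k ⊙ first v ⊕ linComb (mergeExp us) e
    ≡⟨ cong (c + k ∷_) (carry-linComb k e) ⟩
  carry c (k ∷ e) ∎
  where
  open ≡-Reasoning
  𝟘  = replicate (suc v) 0
  us = basis (suc v)

-- With `g j` the number of occurrences of 12⋯(j+1) in `α`, the result is the contribution of `α` in
-- `occr-join`.
carry-tabulate : ∀ v (g : ℕ → ℕ) →
  carry (g 0) (tabulate {n = v} (g ∘ suc ∘ toℕ)) ≡ tabulate λ i → g (toℕ i) + g (suc (toℕ i))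
carry-tabulate zero    g = refl
carry-tabulate (suc v) g = cong (g 0 + g 1 ∷_) (carry-tabulate v (g ∘ suc))

zipWith-tabulate : (f g : Fin v → ℕ) → tabulate f ⊕ tabulate g ≡ tabulate λ i → f i + g i
zipWith-tabulate {zero}  f g = refl
zipWith-tabulate {suc v} f g = cong (f zero + g zero ∷_) (zipWith-tabulate (f ∘ suc) (g ∘ suc))

-- The recurrence for the polynomials

Q-monomials : ∀ m n → Q m n ≡ monomials (weight m) (𝒮132 n)
Q-monomials m n = go (𝒮132 n)
  where
  go : ∀ σs → foldr _+ₚ_ 0ₚ (map (λ σ → monomial (weight m σ)) σs) ≡ monomials (weight m) σs
  go []       = refl
  go (σ ∷ σs) = cong (_ ∷_) (go σs)

module _ (r : ℕ) where
  private
    m  = 2 + r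
    xs = vars (suc r)
    x₂ = var {suc r} zero

  -- `occr-join`, entry by entry: the left side is the exponent that the pair contributes to the
  -- product of the three factors of a summand.
  weight-join : ∀ {k l α β} → Avoider k α → Avoider l β →
    k ⊙ first r ⊕ linComb (mergeExp (basis (suc r))) (weight m α) ⊕ weight m β ≡
      weight m (join (α , β))
  weight-join {k} {l} {α} {β} A B = begin
    k ⊙ first r ⊕ linComb (mergeExp (basis (suc r))) (weight m α) ⊕ weight m β
      ≡⟨ cong (_⊕ weight m β) (carry-linComb k (weight m α)) ⟩
    carry k (weight m α) ⊕ weight m β
      -- `k` is the number of occurrences of the pattern 1, so the carry and the weights of `α` are
      -- values of one function `g`.
      ≡⟨ cong (λ c → carry c (weight m α) ⊕ weight m β) (occr-1 A) ⟨
    carry (g 0) (weight m α) ⊕ weight m β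
      ≡⟨ cong (_⊕ weight m β) (carry-tabulate (suc r) g) ⟩
    tabulate (λ i → g (toℕ i) + g (suc (toℕ i))) ⊕ weight m β
      ≡⟨ zipWith-tabulate (λ i → g (toℕ i) + g (suc (toℕ i))) (λ i → occr (oneTo (2 + toℕ i)) β) ⟩
    tabulate (λ i → g (toℕ i) + g (suc (toℕ i)) + occr (oneTo (2 + toℕ i)) β)
      ≡⟨ Vec.tabulate-cong (λ i → trans
           (cong (_+ occr (oneTo (2 + toℕ i)) β) (ℕ.+-comm (g (toℕ i)) _))
           (sym (occr-join A B (suc (toℕ i))))) ⟩
    weight m (join (α , β)) ∎
    where
    open ≡-Reasoning
    g : ℕ → ℕ
    g j = occr (oneTo (suc j)) α

  -- All three factors are lists of monomials, and multiplication runs through the pairs in the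
  -- order of `pairsAt`; `weight-join` identifies the exponents.
  Q-product : ∀ n i → x₂ ^ₚ i *ₚ Q m i ⟨ mergeNext xs ⟩ *ₚ Q m (n ∸ i) ≡
    monomials (weight m ∘ join) (pairsAt n i)
  Q-product n i = begin
    x₂ ^ₚ i *ₚ Q m i ⟨ mergeNext xs ⟩ *ₚ Q m (n ∸ i)
      ≡⟨ cong₂ _*ₚ_ (cong₂ _*ₚ_ (monomial-^ (first r) i) substituted) (Q-monomials m (n ∸ i)) ⟩
    monomial (i ⊙ first r) *ₚ monomials (L ∘ weight m) (𝒮132 i)
      *ₚ monomials (weight m) (𝒮132 (n ∸ i))
      ≡⟨ cong (_*ₚ monomials (weight m) (𝒮132 (n ∸ i)))
           (monomial-*-monomials (i ⊙ first r) (L ∘ weight m) (𝒮132 i)) ⟩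
    monomials (λ α → i ⊙ first r ⊕ L (weight m α)) (𝒮132 i) *ₚ monomials (weight m) (𝒮132 (n ∸ i))
      ≡⟨ monomials-* _ (weight m) (𝒮132 i) (𝒮132 (n ∸ i)) ⟩
    monomials (λ (α , β) → i ⊙ first r ⊕ L (weight m α) ⊕ weight m β) (pairsAt n i)
      ≡⟨ List.map-cong-local (All.tabulate λ αβ∈ →
           let α∈ , β∈ = ∈.∈-cartesianProduct⁻ (𝒮132 i) (𝒮132 (n ∸ i)) αβ∈
           in cong (1ℤ ,_) (weight-join (∈-𝒮132⁻ {i} α∈) (∈-𝒮132⁻ {n ∸ i} β∈))) ⟩
    monomials (weight m ∘ join) (pairsAt n i) ∎
    where
    open ≡-Reasoning
    L = linComb (mergeExp (basis (suc r)))
    substituted : Q m i ⟨ mergeNext xs ⟩ ≡ monomials (L ∘ weight m) (𝒮132 i)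
    substituted = begin
      Q m i ⟨ mergeNext xs ⟩
        ≡⟨ cong₂ _⟨_⟩ (Q-monomials m i)
             (trans (cong mergeNext (vars-basis (suc r))) (mergeNext-monomial (basis (suc r)))) ⟩
      monomials (weight m) (𝒮132 i) ⟨ Vec.map monomial (mergeExp (basis (suc r))) ⟩
        ≡⟨ ⟨⟩-monomials (mergeExp (basis (suc r))) (weight m) (𝒮132 i) ⟩
      monomials (L ∘ weight m) (𝒮132 i) ∎

  summand : ℕ → ℕ → Poly (suc r)
  summand n k = x₂ ^ₚ (k ∸ 1) *ₚ Q m (k ∸ 1) ⟨ mergeNext xs ⟩ *ₚ Q m (n ∸ k)

  -- Only the passage from `𝒮132 (suc n)` to `map join (pairs n)` reorders terms. In `expand`, `∑`
  -- unfolds to `concat` of a `map`.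
  Q-recurrence : ∀ n → Q m (suc n) ≈ ∑ (oneTo (suc n)) (summand (suc n))
  Q-recurrence n e = begin
    coeff (Q m (suc n)) e
      ≡⟨ cong (λ p → coeff p e) (Q-monomials m (suc n)) ⟩
    coeff (monomials (weight m) (𝒮132 (suc n))) e
      ≡⟨ ↭⇒≈ (↭.map⁺ _ (𝒮132-↭ n)) e ⟩
    coeff (monomials (weight m) (map join (pairs n))) e
      ≡⟨ cong (λ p → coeff p e) expand ⟩
    coeff (∑ (oneTo (suc n)) (summand (suc n))) e ∎
    where
    open ≡-Reasoning
    expand : monomials (weight m) (map join (pairs n)) ≡ ∑ (oneTo (suc n)) (summand (suc n))
    expand = begin
      monomials (weight m) (map join (pairs n))
        ≡⟨ List.map-∘ (pairs n) ⟨
      monomials (weight m ∘ join) (pairs n)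
        ≡⟨ List.concat-map (applyUpTo (pairsAt n) (suc n)) ⟨
      concat (map (monomials (weight m ∘ join)) (applyUpTo (pairsAt n) (suc n)))
        ≡⟨ cong (concat ∘ map _) (List.map-upTo (pairsAt n) (suc n)) ⟨
      concat (map (monomials (weight m ∘ join)) (map (pairsAt n) (upTo (suc n))))
        ≡⟨ cong concat (List.map-∘ (upTo (suc n))) ⟨
      concat (map (monomials (weight m ∘ join) ∘ pairsAt n) (upTo (suc n)))
        -- At index `suc i` the subtractions in `summand` compute to `i` and `n ∸ i`.
        ≡⟨ cong concat (List.map-cong (Q-product n) (upTo (suc n))) ⟨
      concat (map (summand (suc n) ∘ suc) (upTo (suc n)))
        ≡⟨ cong concat (List.map-∘ (upTo (suc n))) ⟩
      concat (map (summand (suc n)) (map suc (upTo (suc n))))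
        ≡⟨ cong (concat ∘ map (summand (suc n))) (List.map-upTo suc (suc n)) ⟩
      ∑ (oneTo (suc n)) (summand (suc n)) ∎

-- The functional equation for the series

∑-applyUpTo : (f : ℕ → Poly v) (g : ℕ → ℕ) (n : ℕ) → ∑ (applyUpTo g n) f ≡ ∑ (upTo n) (f ∘ g)
∑-applyUpTo f g n = cong concat (trans (List.map-applyUpTo g f n) (sym (List.map-upTo (f ∘ g) n)))

∑-zero : ∀ {f : ℕ → Poly v} (n : ℕ) → (∀ i → i < n → f i ≡ 0ₚ) → ∑ (upTo n) f ≡ 0ₚ
∑-zero         zero    _   = refl
∑-zero {f = f} (suc n) f≡0 = cong₂ _++_ (f≡0 0 z<s)
  (trans (∑-applyUpTo f suc n) (∑-zero n λ i i<n → f≡0 (suc i) (s≤s i<n)))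

∑-last : ∀ {f : ℕ → Poly v} (n : ℕ) → (∀ i → i < n → f i ≡ 0ₚ) → ∑ (upTo (suc n)) f ≡ f n
∑-last {f = f} zero    _   = List.++-identityʳ (f 0)
∑-last {f = f} (suc n) f≡0 = cong₂ _++_ (f≡0 0 z<s)
  (trans (∑-applyUpTo f suc (suc n)) (∑-last n λ i i<n → f≡0 (suc i) (s≤s i<n)))

linear-*ₛ-zero : (U F : Series v) → U 0 ≡ 0ₚ → (U *ₛ F) 0 ≡ 0ₚ
linear-*ₛ-zero U F U₀ rewrite U₀ = refl

-- The convolution keeps only index 1. Since zero is the empty list, the other terms disappear
-- without passing to `≈`.
linear-*ₛ-suc : (U F : Series v) → U 0 ≡ 0ₚ → (∀ i → U (2 + i) ≡ 0ₚ) →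
  ∀ n → (U *ₛ F) (suc n) ≡ U 1 *ₚ F n
linear-*ₛ-suc U F U₀ U₂ n rewrite U₀ = trans
  (cong (U 1 *ₚ F n ++_) (trans (∑-applyUpTo _ (2 +_) n)
    (∑-zero n λ i _ → cong (_*ₚ F (n ∸ suc i)) (U₂ i))))
  (List.++-identityʳ (U 1 *ₚ F n))

*ₛ-constₛ : (F : Series v) (p : Poly v) (n : ℕ) → (F *ₛ constₛ p) n ≡ F n *ₚ p
*ₛ-constₛ F p n = trans
  (∑-last n λ i i<n → trans (cong (F i *ₚ_) (vanish i i<n)) (*ₚ-zeroʳ (F i)))
  (cong (λ k → F n *ₚ constₛ p k) (ℕ.n∸n≡0 n))
  where
  vanish : ∀ i → i < n → constₛ p (n ∸ i) ≡ 0ₚ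
  -- Positivity of `n ∸ i` excludes `zero`, where `constₛ p` would be `p`.
  vanish i i<n with suc _ ← n ∸ i | _ ← ℕ.m<n⇒0<n∸m i<n = refl

t*-suc : (F : Series v) (n : ℕ) → (t *ₛ F) (suc n) ≡ F n
t*-suc F n = trans (linear-*ₛ-suc t F refl (λ _ → refl) n) (*ₚ-identityˡ (F n))

module _ (p : Poly v) where
  private U = t *ₛ constₛ p

  -- `U` is p·t, so its n-th power is pⁿtⁿ, concentrated in degree n.
  U^-diagonal : ∀ n → (U ^ₛ n) n ≡ p ^ₚ n
  U^-off : ∀ n i → i ≢ n → (U ^ₛ n) i ≡ 0ₚ
  U^-suc : ∀ n i → (U ^ₛ suc n) (suc i) ≡ p *ₚ (U ^ₛ n) i

  U^-suc n i = trans (linear-*ₛ-suc U (U ^ₛ n) refl (λ i → t*-suc (constₛ p) (suc i)) i)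
    (cong (_*ₚ (U ^ₛ n) i) (t*-suc (constₛ p) 0))

  U^-diagonal zero    = refl
  U^-diagonal (suc n) = trans (U^-suc n n) (cong (p *ₚ_) (U^-diagonal n))

  U^-off zero    zero    0≢0 = contradiction refl 0≢0
  U^-off zero    (suc i) _   = refl
  U^-off (suc n) zero    _   = linear-*ₛ-zero U (U ^ₛ n) refl
  U^-off (suc n) (suc i) i≢n =
    trans (U^-suc n i) (trans (cong (p *ₚ_) (U^-off n i (i≢n ∘ cong suc))) (*ₚ-zeroʳ p))

  -- The truncated sum ends at index `n`, and by `U^-off` its last term is the only one left.
  ⟦⟧-coefficient : (F : Series w) (ys : Vec (Poly v) w) (n : ℕ) →
    (F ⟦ U , ys ⟧) n ≡ p ^ₚ n *ₚ F n ⟨ ys ⟩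
  ⟦⟧-coefficient F ys n = trans
    (∑-last n λ i i<n → trans (*ₛ-constₛ (U ^ₛ i) (F i ⟨ ys ⟩) n)
      (cong (_*ₚ F i ⟨ ys ⟩) (U^-off i n (ℕ.<⇒≢ i<n ∘ sym))))
    (trans (*ₛ-constₛ (U ^ₛ n) (F n ⟨ ys ⟩) n) (cong (_*ₚ F n ⟨ ys ⟩) (U^-diagonal n)))

weight-[] : ∀ m → weight m [] ≡ replicate (m ∸ 1) 0
weight-[] m = trans (Vec.tabulate-∘ (λ _ → 0) id) (Vec.map-const _ 0)

theorem4 : (r : ℕ) →
    let m  = 2 + r
        xs = vars (m ∸ 1)
        x₂ = var {m ∸ 1} zero
    in
    ((n : ℕ) → 1 ≤ n →
      Q m n ≈ ∑ (oneTo n) (λ k → x₂ ^ₚ (k ∸ 1) *ₚ Q m (k ∸ 1) ⟨ mergeNext xs ⟩ *ₚ Q m (n ∸ k)))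
    ×
    (Qₜ m ≈ₛ 1ₛ +ₛ t *ₛ Qₜ m ⟦ t *ₛ constₛ x₂ , mergeNext xs ⟧ *ₛ Qₜ m)
theorem4 r = (λ { (suc n) _ → Q-recurrence r n }) , λ where
    -- `𝒮132 0` holds only the empty word, and the product beginning with `t` has no terms in degree
    -- 0.
    zero    → ≡⇒≈ (cong monomial (weight-[] m))
    (suc n) e → trans (Q-recurrence r n e) (cong (λ p → coeff p e) (sym (tFQ n)))
  where
  m  = 2 + r
  xs = vars (suc r)
  x₂ = var {suc r} zero
  F = Qₜ m ⟦ t *ₛ constₛ x₂ , mergeNext xs ⟧
  tFQ : ∀ n → (t *ₛ F *ₛ Qₜ m) (suc n) ≡ ∑ (oneTo (suc n)) (summand r (suc n))
  tFQ n = begin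
    -- The index 0 term of the convolution computes to the empty list, which leaves `oneTo (suc n)`
    -- from `upTo (2 + n)`.
    ∑ (oneTo (suc n)) (λ k → (t *ₛ F) k *ₚ Q m (suc n ∸ k))
      ≡⟨ ∑-applyUpTo _ suc (suc n) ⟩
    ∑ (upTo (suc n)) (λ i → (t *ₛ F) (suc i) *ₚ Q m (n ∸ i))
      ≡⟨ cong concat (List.map-cong (λ i → cong (_*ₚ Q m (n ∸ i))
           (trans (t*-suc F i) (⟦⟧-coefficient x₂ (Qₜ m) (mergeNext xs) i))) (upTo (suc n))) ⟩
    ∑ (upTo (suc n)) (summand r (suc n) ∘ suc)
      ≡⟨ ∑-applyUpTo (summand r (suc n)) suc (suc n) ⟨
    ∑ (oneTo (suc n)) (summand r (suc n)) ∎
    where open ≡-Reasoning
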